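{- Let $Sp(K,S)$ be a split graph with biadjacency matrix $R$. Then: (1) $(x_K,x_S)\in\mathcal{N}(Sp)$ if and only if $(I-J)x_K=Rx_S$ and $R^tx_K=0$. (2) $\{(0,z)^t: z\in\mathcal{N}(R)\}\subseteq\mathcal{N}(Sp)$; equality holds if and only if $\operatorname{Supp}(Sp)\subseteq S$. (3) $\operatorname{nl}(Sp)\ge\operatorname{nl}(R)=|S|-\operatorname{rk}(R)$; equality $\operatorname{nl}(Sp)=\operatorname{nl}(R)$ holds if and only if $\operatorname{Supp}(Sp)\subseteq S$. (4) If $(x_K,x_S)\in\mathcal{N}(Sp)$ and $\mathbf{1}^tx_K=0$, then $x_K=0$. (5) If $\mathbf{1}\in\operatorname{im}(R)$, then $\operatorname{Supp}(Sp)\subseteq S$.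
   Context: Graphs are finite and simple. A split graph is a graph $Sp$ whose vertex set is a disjoint union of a clique $K$ and an independent set $S$; the pair $(K,S)$ is called an s-partition, and $Sp(K,S)$ denotes $Sp$ together with this s-partition. Both $K$ and $S$ are assumed nonempty. With the vertices ordered as $(K,S)$, the adjacency matrix is \[A(Sp)=\begin{pmatrix} J-I & R\\ R^t & 0\end{pmatrix},\] where $J$ is an all-ones matrix, $I$ the identity, and $R$ is the $|K|\times|S|$ $0/1$ biadjacency matrix ($R_{uv}=1$ iff $u\in K$ and $v\in S$ are adjacent). Vectors indexed by $V(Sp)$ are written $(x_K,x_S)$ with $x_K\in\mathbb{R}^{|K|}$, $x_S\in\mathbb{R}^{|S|}$. All matrices are real; $\mathcal{N}(A)$, $\operatorname{nl}(A)$, $\operatorname{rk}(A)$, $\operatorname{im}(A)$ are the nullspace, nullity, rank and column space of $A$; $\mathcal{N}(Sp)$ and $\operatorname{nl}(Sp)$ are those of $A(Sp)$. $\mathbf{1}$ is the all-ones column vector. $\operatorname{Supp}(Sp)$ is the set of vertices $v$ such that $x_v\ne 0$ for some $x\in\mathcal{N}(Sp)$. -}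

module Defs where

open import Level using (Level; _⊔_; suc; 0ℓ)
open import Algebra.Bundles using (CommutativeRing)
open import Data.Bool.Base using (if_then_else_)
open import Data.Fin.Base using (Fin; _↑ˡ_; _↑ʳ_)
open import Data.Fin.Properties using (_≟_)
open import Data.Nat.Base as ℕ using (ℕ; NonZero)
open import Data.Product.Base using (∃; _×_; Σ-syntax)
open import Data.Vec.Functional using (Vector; replicate; _++_)
open import Relation.Binary.Core using (Rel)
open import Relation.Binary.Definitions using (Decidable; Symmetric; Irreflexive)
open import Relation.Binary.PropositionalEquality using (_≡_; _≢_)
open import Relation.Binary.Structures using (IsStrictTotalOrder)
import Relation.Binary.Construct.StrictToNonStrict as StrictToNonStrict
import Algebra.Definitions.RawMonoid as RawMonoidDefs
import Data.Vec.Functional.Relation.Binary.Equality.Setoid as VectorEquality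
open import Relation.Nullary using (¬_; does)
open import Relation.Unary using (Pred; Satisfiable)

-- The (classical) real numbers, axiomatised as a Dedekind-complete totally
-- ordered field; classically this determines them up to isomorphism.
-- IsStrictTotalOrder includes trichotomy, so _≈_ and _<_ are decidable.
record Reals c ℓ₁ ℓ₂ : Set (suc (c ⊔ ℓ₁ ⊔ ℓ₂)) where
  infix 4 _<_
  field
    commutativeRing : CommutativeRing c ℓ₁

  open CommutativeRing commutativeRing public

  field
    _<_                : Rel Carrier ℓ₂
    isStrictTotalOrder : IsStrictTotalOrder _≈_ _<_
    0<1                : 0# < 1#
    inverse            : ∀ x → x ≉ 0# → ∃ λ y → x * y ≈ 1#
    +-monoˡ-<          : ∀ {x y} z → x < y → x + z < y + z
    *-pos              : ∀ {x y} → 0# < x → 0# < y → 0# < x * y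

  open StrictToNonStrict _≈_ _<_ public using (_≤_)

  UpperBound : ∀ {p} → Pred Carrier p → Pred Carrier (c ⊔ ℓ₁ ⊔ ℓ₂ ⊔ p)
  UpperBound P b = ∀ x → P x → x ≤ b

  LeastUpperBound : ∀ {p} → Pred Carrier p → Pred Carrier (c ⊔ ℓ₁ ⊔ ℓ₂ ⊔ p)
  LeastUpperBound P b = UpperBound P b × (∀ b′ → UpperBound P b′ → b ≤ b′)

  field
    complete : (P : Pred Carrier (c ⊔ ℓ₁ ⊔ ℓ₂)) →
               Satisfiable P → Satisfiable (UpperBound P) →
               Satisfiable (LeastUpperBound P)

record Graph (n : ℕ) : Set₁ where
  infix 4 _~_ _~?_
  field
    _~_      : Rel (Fin n) 0ℓ
    _~?_     : Decidable _~_
    ~-sym    : Symmetric _~_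
    ~-irrefl : Irreflexive _≡_ _~_

-- A split graph together with an s-partition (K , S), |K| = k and |S| = s.
-- The vertices are ordered as (K , S): the vertices of K are the i ↑ˡ s,
-- those of S are the k ↑ʳ j.
record SplitGraph (k s : ℕ) : Set₁ where
  field
    graph : Graph (k ℕ.+ s)

  open Graph graph public

  field
    .{{K-nonempty}} : NonZero k
    .{{S-nonempty}} : NonZero s
    K-clique        : ∀ (i j : Fin k) → i ≢ j → (i ↑ˡ s) ~ (j ↑ˡ s)
    S-independent   : ∀ (i j : Fin s) → ¬ ((k ↑ʳ i) ~ (k ↑ʳ j))

  S-side : Pred (Fin (k ℕ.+ s)) 0ℓ
  S-side v = ∃ λ j → v ≡ k ↑ʳ j

module LinearAlgebra {c ℓ₁ ℓ₂} (ℝ : Reals c ℓ₁ ℓ₂) where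

  open Reals ℝ
  open RawMonoidDefs +-rawMonoid public using (sum)
  open VectorEquality setoid public using (_≋_)

  private
    variable
      k s m n : ℕ
      p : Level

  infixl 7 _*ᵥ_ _·_
  infixl 6 _⊟_
  infix  8 _ᵗ

  Vec : ℕ → Set c
  Vec n = Vector Carrier n

  Matrix : ℕ → ℕ → Set c
  Matrix m n = Fin m → Fin n → Carrier

  𝟎 : Vec n
  𝟎 {n} = replicate n 0#

  𝟏 : Vec n
  𝟏 {n} = replicate n 1#

  _·_ : Vec n → Vec n → Carrier
  x · y = sum (λ i → x i * y i)

  _*ᵥ_ : Matrix m n → Vec n → Vec m
  (A *ᵥ x) i = A i · x

  _ᵗ : Matrix m n → Matrix n m
  (A ᵗ) i j = A j i

  _⊟_ : Matrix m n → Matrix m n → Matrix m n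
  (A ⊟ B) i j = A i j - B i j

  I : Matrix n n
  I i j = if does (i ≟ j) then 1# else 0#

  J : Matrix m n
  J i j = 1#

  nullspace : Matrix m n → Pred (Vec n) ℓ₁
  nullspace A x = A *ᵥ x ≋ 𝟎

  im : Matrix m n → Pred (Vec m) (c ⊔ ℓ₁)
  im A y = ∃ λ x → A *ᵥ x ≋ y

  combination : ∀ {d} → Vec d → Vector (Vec n) d → Vec n
  combination a b j = sum (λ i → a i * b i j)

  record IsBasis {d} (V : Pred (Vec n) p) (b : Vector (Vec n) d) : Set (c ⊔ ℓ₁ ⊔ p) where
    field
      members     : ∀ i → V (b i)
      independent : ∀ a → combination a b ≋ 𝟎 → a ≋ 𝟎
      spanning    : ∀ x → V x → ∃ λ a → combination a b ≋ x

  -- "V has a basis of d vectors": the dimension as a relation, so results about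
  -- it have to assert the existence of d as well as properties of every such d.
  HasDimension : Pred (Vec n) p → ℕ → Set (c ⊔ ℓ₁ ⊔ p)
  HasDimension {n} V d = Σ[ b ∈ Vector (Vec n) d ] IsBasis V b

  HasNullity : Matrix m n → ℕ → Set (c ⊔ ℓ₁)
  HasNullity A = HasDimension (nullspace A)

  HasRank : Matrix m n → ℕ → Set (c ⊔ ℓ₁)
  HasRank A = HasDimension (im A)

  adjacency : Graph n → Matrix n n
  adjacency G u v = if does (u ~? v) then 1# else 0#
    where open Graph G

  biadjacency : SplitGraph k s → Matrix k s
  biadjacency {k} {s} Sp i j = adjacency (SplitGraph.graph Sp) (i ↑ˡ s) (k ↑ʳ j)

  𝒩 : Graph n → Pred (Vec n) ℓ₁
  𝒩 G = nullspace (adjacency G)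

  Supp : Graph n → Pred (Fin n) (c ⊔ ℓ₁)
  Supp G v = ∃ λ x → 𝒩 G x × x v ≉ 0#

  -- { (0 , z) : z ∈ V }
  ZeroExtension : ∀ k → Pred (Vec s) p → Pred (Vec (k ℕ.+ s)) (c ⊔ ℓ₁ ⊔ p)
  ZeroExtension k V x = ∃ λ z → V z × 𝟎 {k} ++ z ≋ x

-- The rows of A(Sp) turn A(Sp) x = 0 into (I - J) x_K = R x_S and Rᵗ x_K = 0.
-- When 1ᵗ x_K = 0 this gives x_K = R x_S, hence |x_K|² = x_Kᵗ R x_S = 0.  When
-- 1 = R y, 1ᵗ x_K = yᵗ Rᵗ x_K = 0.  The nullity of R is at most that of Sp because
-- z ↦ (0 , z) embeds N(R) in N(Sp), and if the two agree, the image of a basis of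
-- N(R) already spans N(Sp).  Bases, rank-nullity and the uniqueness of dimension
-- all come from one Gaussian elimination, which is effective since _≈_ is decidable.
module Submission where

open import Defs
open import Level using (Level; _⊔_)
open import Data.Bool.Base using (if_then_else_)
open import Data.Fin.Base using (Fin; zero; suc; punchIn; punchOut; splitAt; fromℕ<; _↑ˡ_; _↑ʳ_)
open import Data.Fin.Properties using (any?; punchIn-punchOut; splitAt-↑ˡ; splitAt-↑ʳ; splitAt⁻¹-↑ˡ; splitAt⁻¹-↑ʳ) renaming (_≟_ to _≟ᶠ_)
open import Data.Integer.Base using (+_; _⊖_)
open import Data.Integer.Properties using (⊖-≥)
open import Data.Nat.Base as ℕ using (ℕ; zero; suc; _≥_)
import Data.Nat.Properties as ℕ
open import Data.Product.Base using (∃; _×_; _,_; proj₁; proj₂)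
open import Data.Sum.Base using (_⊎_; inj₁; inj₂)
open import Data.Vec.Functional using (Vector; _++_; _∷_; []; insertAt; removeAt; take; drop)
open import Data.Vec.Functional.Properties using (lookup-++ˡ; lookup-++ʳ; insertAt-lookup; insertAt-punchIn)
open import Function.Base using (_∘_; id)
open import Function.Bundles using (_⇔_; mk⇔; Equivalence)
open import Relation.Binary.Definitions using (tri<; tri≈; tri>)
open import Relation.Binary.PropositionalEquality as ≡ using (_≡_)
open import Relation.Binary.Structures using (IsStrictTotalOrder)
open import Relation.Nullary using (¬_; yes; no; contradiction)
open import Relation.Nullary.Decidable using (¬?; decidable-stable; dec-true; dec-false)
open import Relation.Unary using (Pred; _∈_; _⊆_; _≐_)
import Algebra.Properties.Ring as RingProperties
import Algebra.Properties.Semiring.Sum as SemiringSum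
import Algebra.Solver.Ring.NaturalCoefficients.Default as SemiringSolver
import Relation.Binary.Reasoning.Setoid as SetoidReasoning
import Data.Vec.Functional.Relation.Binary.Equality.Setoid as VectorEquality

module RealLinearAlgebra {c ℓ₁ ℓ₂ : Level} (ℝ : Reals c ℓ₁ ℓ₂) where

  open Reals ℝ hiding (zero)
  open LinearAlgebra ℝ
  open IsStrictTotalOrder isStrictTotalOrder
    using (compare; _≟_; irrefl; <-respʳ-≈; <-respˡ-≈)
    renaming (trans to <-trans)
  open RingProperties ring
  open SemiringSum semiring
    using (sum-cong-≋; sum-replicate-zero; ∑-distrib-+; ∑-comm; sum-remove; *-distribˡ-sum; *-distribʳ-sum)
  open SemiringSolver commutativeSemiring using (solve; _:+_; _:*_; _:=_)
  open SetoidReasoning setoid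
  open VectorEquality setoid using (≋-refl; ≋-sym; ≋-trans)

  private
    variable
      k s m n d e : ℕ
      p q : Level

  -- Ordered-field facts and positive definiteness of the dot product.

  1≉0 : 1# ≉ 0#
  1≉0 1≈0 = irrefl (sym 1≈0) 0<1

  *-cancelʳ-≈0 : ∀ {x y} → y ≉ 0# → x * y ≈ 0# → x ≈ 0#
  *-cancelʳ-≈0 {x} {y} y≉0 xy≈0 = begin
    x                 ≈⟨ *-identityʳ x ⟨
    x * 1#            ≈⟨ *-congˡ (proj₂ (inverse y y≉0)) ⟨
    x * (y * y⁻¹)     ≈⟨ *-assoc x y y⁻¹ ⟨
    x * y * y⁻¹       ≈⟨ *-congʳ xy≈0 ⟩
    0# * y⁻¹          ≈⟨ zeroˡ y⁻¹ ⟩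
    0#                ∎
    where y⁻¹ = proj₁ (inverse y y≉0)

  +-pos : ∀ {x y} → 0# < x → 0# < y → 0# < x + y
  +-pos {x} {y} 0<x 0<y = <-trans 0<y (<-respˡ-≈ (+-identityˡ y) (+-monoˡ-< y 0<x))

  x<0⇒0<-x : ∀ {x} → x < 0# → 0# < - x
  x<0⇒0<-x {x} x<0 =
    <-respʳ-≈ (+-identityˡ (- x)) (<-respˡ-≈ (-‿inverseʳ x) (+-monoˡ-< (- x) x<0))

  -x*-y≈x*y : ∀ x y → - x * - y ≈ x * y
  -x*-y≈x*y x y = begin
    - x * - y     ≈⟨ -‿distribˡ-* x (- y) ⟨
    - (x * - y)   ≈⟨ -‿cong (-‿distribʳ-* x y) ⟨
    - - (x * y)   ≈⟨ -‿involutive (x * y) ⟩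
    x * y         ∎

  x≉0⇒0<x*x : ∀ {x} → x ≉ 0# → 0# < x * x
  x≉0⇒0<x*x {x} x≉0 with compare x 0#
  ... | tri< x<0 _ _ = <-respʳ-≈ (-x*-y≈x*y x x) (*-pos (x<0⇒0<-x x<0) (x<0⇒0<-x x<0))
  ... | tri≈ _ x≈0 _ = contradiction x≈0 x≉0
  ... | tri> _ _ 0<x = *-pos 0<x 0<x

  -- The disjunction makes the induction go through: `+-pos` adds only strictly positive terms, so
  -- the tail has to report whether it contributes zero or a positive amount.
  ≋𝟎⊎0<x·x : (x : Vec n) → x ≋ 𝟎 ⊎ 0# < x · x
  ≋𝟎⊎0<x·x {zero}  x = inj₁ λ ()
  ≋𝟎⊎0<x·x {suc n} x with x zero ≟ 0# | ≋𝟎⊎0<x·x (x ∘ suc)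
  ... | yes x₀≈0 | inj₁ xs≋𝟎   = inj₁ λ { zero → x₀≈0 ; (suc i) → xs≋𝟎 i }
  ... | yes x₀≈0 | inj₂ 0<xs·xs = inj₂ (<-respʳ-≈ (begin
    (x ∘ suc) · (x ∘ suc)        ≈⟨ +-identityˡ _ ⟨
    0# + (x ∘ suc) · (x ∘ suc)   ≈⟨ +-congʳ (trans (*-congʳ x₀≈0) (zeroˡ _)) ⟨
    x · x                        ∎) 0<xs·xs)
  ... | no x₀≉0 | inj₂ 0<xs·xs = inj₂ (+-pos (x≉0⇒0<x*x x₀≉0) 0<xs·xs)
  ... | no x₀≉0 | inj₁ xs≋𝟎   = inj₂ (<-respʳ-≈ (begin
    x zero * x zero                          ≈⟨ +-identityʳ _ ⟨
    x zero * x zero + 0#                     ≈⟨ +-congˡ (sum-replicate-zero n) ⟨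
    x zero * x zero + sum {n} (λ _ → 0#)     ≈⟨ +-congˡ (sum-cong-≋ λ i → trans (*-congʳ (xs≋𝟎 i)) (zeroˡ _)) ⟨
    x · x                                    ∎) (x≉0⇒0<x*x x₀≉0))

  -- The order is essential here: over the complex numbers a nonzero vector can be orthogonal to
  -- itself under this product.
  x·x≈0⇒x≋𝟎 : (x : Vec n) → x · x ≈ 0# → x ≋ 𝟎
  x·x≈0⇒x≋𝟎 x x·x≈0 with ≋𝟎⊎0<x·x x
  ... | inj₁ x≋𝟎   = x≋𝟎
  ... | inj₂ 0<x·x = contradiction 0<x·x (irrefl (sym x·x≈0))

  -- Dot products and linear combinations

  ·-cong : {x x′ y y′ : Vec n} → x ≋ x′ → y ≋ y′ → x · y ≈ x′ · y′
  ·-cong x≋x′ y≋y′ = sum-cong-≋ λ i → *-cong (x≋x′ i) (y≋y′ i)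

  ·-congˡ : (x : Vec n) {y y′ : Vec n} → y ≋ y′ → x · y ≈ x · y′
  ·-congˡ x = ·-cong {x = x} ≋-refl

  ·-congʳ : (y : Vec n) {x x′ : Vec n} → x ≋ x′ → x · y ≈ x′ · y
  ·-congʳ y x≋x′ = ·-cong {y = y} x≋x′ ≋-refl

  ·-comm : (x y : Vec n) → x · y ≈ y · x
  ·-comm x y = sum-cong-≋ λ i → *-comm (x i) (y i)

  ·-zeroˡ : (y : Vec n) → 𝟎 · y ≈ 0#
  ·-zeroˡ {n} y = trans (sum-cong-≋ λ i → zeroˡ (y i)) (sum-replicate-zero n)

  ·-zeroʳ : (x : Vec n) → x · 𝟎 ≈ 0#
  ·-zeroʳ {n} x = trans (sum-cong-≋ λ i → zeroʳ (x i)) (sum-replicate-zero n)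

  ·-distribʳ-+ : (x y z : Vec n) → (λ i → x i + y i) · z ≈ x · z + y · z
  ·-distribʳ-+ x y z = trans (sum-cong-≋ λ i → distribʳ (z i) (x i) (y i))
                             (∑-distrib-+ (λ i → x i * z i) (λ i → y i * z i))

  ·-*-assoc : ∀ a (x y : Vec n) → (λ i → a * x i) · y ≈ a * (x · y)
  ·-*-assoc a x y = trans (sum-cong-≋ λ i → *-assoc a (x i) (y i))
                          (sym (*-distribˡ-sum a (λ i → x i * y i)))

  ·-negˡ : (x y : Vec n) → (λ i → - x i) · y ≈ - (x · y)
  ·-negˡ x y = begin
    (λ i → - x i) · y        ≈⟨ sum-cong-≋ (λ i → *-congʳ (-1*x≈-x (x i))) ⟨
    (λ i → - 1# * x i) · y   ≈⟨ ·-*-assoc (- 1#) x y ⟩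
    - 1# * (x · y)           ≈⟨ -1*x≈-x (x · y) ⟩
    - (x · y)                ∎

  -- Interchange of two finite sums. Since `combination a b` is `b ᵗ *ᵥ a` up to commuting products,
  -- the same interchange yields the laws for combinations below.
  *ᵥ-adjoint : (A : Matrix m n) (x : Vec m) (y : Vec n) → x · (A *ᵥ y) ≈ (A ᵗ *ᵥ x) · y
  *ᵥ-adjoint A x y = begin
    sum (λ i → x i * sum (λ j → A i j * y j))     ≈⟨ sum-cong-≋ (λ i → *-distribˡ-sum (x i) (λ j → A i j * y j)) ⟩
    sum (λ i → sum (λ j → x i * (A i j * y j)))   ≈⟨ ∑-comm (λ i j → x i * (A i j * y j)) ⟩
    sum (λ j → sum (λ i → x i * (A i j * y j)))   ≈⟨ sum-cong-≋ (λ j → sum-cong-≋ λ i →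
                                                       solve 3 (λ a b c → a :* (b :* c) := (b :* a) :* c) refl (x i) (A i j) (y j)) ⟩
    sum (λ j → sum (λ i → A i j * x i * y j))     ≈⟨ sum-cong-≋ (λ j → *-distribʳ-sum (y j) (λ i → A i j * x i)) ⟨
    sum (λ j → sum (λ i → A i j * x i) * y j)     ∎

  *ᵥ-cong : (A : Matrix m n) {x y : Vec n} → x ≋ y → A *ᵥ x ≋ A *ᵥ y
  *ᵥ-cong A x≋y i = ·-congˡ (A i) x≋y

  nullspace-resp-≋ : (A : Matrix m n) {x y : Vec n} → x ≋ y → x ∈ nullspace A → y ∈ nullspace A
  nullspace-resp-≋ A x≋y Ax≋𝟎 i = trans (*ᵥ-cong A (≋-sym x≋y) i) (Ax≋𝟎 i)

  combination-congˡ : {a a′ : Vec d} (b : Vector (Vec n) d) → a ≋ a′ → combination a b ≋ combination a′ b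
  combination-congˡ b a≋a′ j = ·-congʳ (λ i → b i j) a≋a′

  combination-congʳ : (a : Vec d) {b b′ : Vector (Vec n) d} → (∀ i → b i ≋ b′ i) → combination a b ≋ combination a b′
  combination-congʳ a b≋b′ j = ·-congˡ a (λ i → b≋b′ i j)

  ·-combination : (x : Vec n) (a : Vec d) (b : Vector (Vec n) d) → x · combination a b ≈ a · (λ i → x · b i)
  ·-combination x a b = begin
    x · combination a b    ≈⟨ ·-congˡ x (λ j → ·-comm a (λ i → b i j)) ⟩
    x · (b ᵗ *ᵥ a)         ≈⟨ *ᵥ-adjoint (b ᵗ) x a ⟩
    (b *ᵥ x) · a           ≈⟨ ·-comm (b *ᵥ x) a ⟩
    a · (b *ᵥ x)           ≈⟨ ·-congˡ a (λ i → ·-comm (b i) x) ⟩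
    a · (λ i → x · b i)    ∎

  -- Turns a linear relation among coordinate vectors into one among the vectors that they
  -- represent.
  combination-assoc : (a : Vec e) (C : Matrix e d) (b : Vector (Vec n) d) →
                      combination a (λ i → combination (C i) b) ≋ combination (combination a C) b
  combination-assoc a C b j = begin
    a · (λ i → C i · bⱼ)     ≈⟨ *ᵥ-adjoint C a bⱼ ⟩
    (C ᵗ *ᵥ a) · bⱼ          ≈⟨ ·-congʳ bⱼ (λ i → ·-comm (λ l → C l i) a) ⟩
    combination a C · bⱼ     ∎
    where
    bⱼ = λ i → b i j

  I-diag : (i : Fin n) → I i i ≡ 1#
  I-diag zero    = ≡.refl
  I-diag (suc i) = I-diag i

  I-· : (i : Fin n) (x : Vec n) → I i · x ≈ x i
  I-· zero    x = trans (+-cong (*-identityˡ (x zero)) (·-zeroˡ (x ∘ suc))) (+-identityʳ (x zero))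
  I-· (suc i) x = trans (+-cong (zeroˡ (x zero)) (I-· i (x ∘ suc))) (+-identityˡ (x (suc i)))

  combination-I : (a : Vec n) → combination a I ≋ a
  combination-I a zero    = trans (+-cong (*-identityʳ (a zero)) (·-zeroʳ (a ∘ suc))) (+-identityʳ (a zero))
  combination-I a (suc j) = trans (+-cong (zeroʳ (a zero)) (combination-I (a ∘ suc) j)) (+-identityˡ (a (suc j)))

  -- Bases and dimension

  -- Linearity is encoded as compatibility with combinations of any length, the form in which bases
  -- are transported; `cong` is a field because vectors are compared by `_≋_`.
  record IsLinear (f : Vec m → Vec n) : Set (c ⊔ ℓ₁) where
    field
      cong             : ∀ {x y} → x ≋ y → f x ≋ f y
      combination-homo : ∀ {d} (a : Vec d) (b : Vector (Vec m) d) →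
                         f (combination a b) ≋ combination a (f ∘ b)

  id-isLinear : IsLinear {n} id
  id-isLinear = record { cong = id ; combination-homo = λ a b → ≋-refl }

  -- A relation among the images pulls back through the zero kernel, and the coordinates of a
  -- preimage serve for its image. Used both for elimination steps and for embedding the nullspace
  -- of `R`.
  HasDimension-map : {V : Pred (Vec m) p} {W : Pred (Vec n) q} {f : Vec m → Vec n} →
                     IsLinear f → (∀ x → f x ≋ 𝟎 → x ≋ 𝟎) →
                     (∀ {x} → V x → W (f x)) → (∀ {y} → W y → ∃ λ x → V x × f x ≋ y) →
                     HasDimension V d → HasDimension W d
  HasDimension-map {f = f} linear f-injective V→W W→V (b , isBasis) = f ∘ b , record
    { members     = λ i → V→W (members i)
    ; independent = λ a ab≋𝟎 → independent a (f-injective _ (≋-trans (combination-homo a b) ab≋𝟎))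
    ; spanning    = λ y Wy →
        let x , Vx , fx≋y = W→V Wy
            a , ab≋x      = spanning x Vx
        in a , ≋-trans (≋-sym (combination-homo a b)) (≋-trans (cong ab≋x) fx≋y)
    }
    where
    open IsBasis isBasis
    open IsLinear linear

  -- Rank-nullity by Gaussian elimination.

  record RankNullity (A : Matrix m n) : Set (c ⊔ ℓ₁) where
    field
      {nullity rank} : ℕ
      nullspaceBasis : HasNullity A nullity
      imageBasis     : HasRank A rank
      nullity+rank≡n : nullity ℕ.+ rank ≡ n
      -- This bound gives a matrix with more columns than rows a positive nullity.
      rank≤m         : rank ℕ.≤ m

  noRows-rankNullity : (A : Matrix zero n) → RankNullity A
  noRows-rankNullity {n} A = record
    -- The rows of `I`, read as a family of vectors, are the standard basis.
    { nullspaceBasis = I , record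
      { members     = λ _ ()
      ; independent = λ a aI≋𝟎 → ≋-trans (≋-sym (combination-I a)) aI≋𝟎
      ; spanning    = λ x _ → x , combination-I x
      }
    ; imageBasis = [] , record
      { members     = λ ()
      ; independent = λ _ _ ()
      ; spanning    = λ _ _ → [] , λ ()
      }
    ; nullity+rank≡n = ℕ.+-identityʳ n
    ; rank≤m         = ℕ.z≤n
    }

  -- A zero row imposes no condition on the nullspace and only prefixes `0#` to every vector of the
  -- image, so both dimensions are unchanged.
  zeroRow-rankNullity : (A : Matrix (suc m) n) → A zero ≋ 𝟎 →
                        RankNullity (A ∘ suc) → RankNullity A
  zeroRow-rankNullity A A₀≋𝟎 R = record
    { nullspaceBasis = HasDimension-map id-isLinear (λ _ → id)
        (λ Ax≋𝟎 → λ { zero → A₀·x≈0 _ ; (suc i) → Ax≋𝟎 i })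
        (λ {x} Ax≋𝟎 → x , Ax≋𝟎 ∘ suc , ≋-refl)
        nullspaceBasis
    ; imageBasis = HasDimension-map {f = 0# ∷_}
        (record
          { cong             = λ x≋y → λ { zero → refl ; (suc i) → x≋y i }
          ; combination-homo = λ a b → λ { zero → sym (·-zeroʳ a) ; (suc i) → refl }
          })
        (λ x 0∷x≋𝟎 → 0∷x≋𝟎 ∘ suc)
        (λ (x , Ax≋y) → x , λ { zero → A₀·x≈0 x ; (suc i) → Ax≋y i })
        (λ {y} (x , Ax≋y) → y ∘ suc , (x , Ax≋y ∘ suc) ,
          λ { zero → trans (sym (A₀·x≈0 x)) (Ax≋y zero) ; (suc i) → refl })
        imageBasis
    ; nullity+rank≡n = nullity+rank≡n
    ; rank≤m         = ℕ.m≤n⇒m≤1+n rank≤m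
    }
    where
    open RankNullity R
    A₀·x≈0 : ∀ x → A zero · x ≈ 0#
    A₀·x≈0 x = trans (·-congʳ x A₀≋𝟎) (·-zeroˡ x)

  ≋-by-removeAt : ∀ j {x y : Vec (suc n)} → x j ≈ y j → removeAt x j ≋ removeAt y j → x ≋ y
  ≋-by-removeAt j {x} {y} xⱼ≈yⱼ x≋y i with j ≟ᶠ i
  ... | yes ≡.refl = xⱼ≈yⱼ
  ... | no j≢i     = ≡.subst (λ l → x l ≈ y l) (punchIn-punchOut j≢i) (x≋y (punchOut j≢i))

  ·-removeAt : ∀ j (x y : Vec (suc n)) → x · y ≈ x j * y j + removeAt x j · removeAt y j
  ·-removeAt j x y = sum-remove {i = j} (λ i → x i * y i)

  -- One step of Gaussian elimination with pivot A zero j: the change of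
  -- variables x = lift t x′ satisfies A x = t A₋ⱼ + B x′, where A₋ⱼ is the j-th
  -- column of A and B has zero first row.
  module Pivot (A : Matrix (suc m) (suc n)) (j : Fin (suc n)) (pivot≉0 : A zero j ≉ 0#) where

    pivot⁻¹ : Carrier
    pivot⁻¹ = proj₁ (inverse (A zero j) pivot≉0)

    -- Solving the equation `A zero · x ≈ 0#` for `x j` expresses it as the dot product of these
    -- coefficients with the remaining coordinates.
    multiplier : Vec n
    multiplier l = - (A zero (punchIn j l) * pivot⁻¹)

    B : Matrix (suc m) n
    B i l = A i (punchIn j l) + A i j * multiplier l

    lift : Carrier → Vec n → Vec (suc n)
    lift t x = insertAt x j (t + multiplier · x)

    lift-pivot : ∀ t x → lift t x j ≈ t + multiplier · x
    lift-pivot t x = reflexive (insertAt-lookup x j _)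

    lift-removeAt : ∀ t x → removeAt (lift t x) j ≋ x
    lift-removeAt t x l = reflexive (insertAt-punchIn x j _ l)

    lift-cong : ∀ {t t′ x x′} → t ≈ t′ → x ≋ x′ → lift t x ≋ lift t′ x′
    lift-cong {t} {t′} {x} {x′} t≈t′ x≋x′ = ≋-by-removeAt j
      (trans (lift-pivot t x) (trans (+-cong t≈t′ (·-congˡ multiplier x≋x′)) (sym (lift-pivot t′ x′))))
      (≋-trans (lift-removeAt t x) (≋-trans x≋x′ (≋-sym (lift-removeAt t′ x′))))

    -- Recovers `t` from `lift t x′`. It amounts to `A zero · x` divided by the pivot, and so
    -- vanishes exactly when the first equation holds.
    parameter : Vec (suc n) → Carrier
    parameter x = x j - multiplier · removeAt x j

    lift-parameter : ∀ x → lift (parameter x) (removeAt x j) ≋ x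
    lift-parameter x = ≋-by-removeAt j
      (begin
        lift (parameter x) x′ j     ≈⟨ lift-pivot (parameter x) x′ ⟩
        x j - u + u                 ≈⟨ +-assoc (x j) (- u) u ⟩
        x j + (- u + u)             ≈⟨ +-congˡ (-‿inverseˡ u) ⟩
        x j + 0#                    ≈⟨ +-identityʳ (x j) ⟩
        x j                         ∎)
      (lift-removeAt (parameter x) x′)
      where
      x′ = removeAt x j
      u  = multiplier · x′

    -- For a nonzero `t` the map `lift t` is merely affine; at `0#` the inserted coordinate is
    -- linear in the others.
    lift₀-isLinear : IsLinear (lift 0#)
    lift₀-isLinear = record
      { cong             = lift-cong refl
      ; combination-homo = λ a b → ≋-by-removeAt j
          (begin
            lift 0# (combination a b) j                 ≈⟨ lift-pivot 0# (combination a b) ⟩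
            0# + multiplier · combination a b           ≈⟨ +-identityˡ _ ⟩
            multiplier · combination a b                ≈⟨ ·-combination multiplier a b ⟩
            a · (λ i → multiplier · b i)                ≈⟨ ·-congˡ a (λ i → +-identityˡ _) ⟨
            a · (λ i → 0# + multiplier · b i)           ≈⟨ ·-congˡ a (λ i → lift-pivot 0# (b i)) ⟨
            combination a (lift 0# ∘ b) j               ∎)
          (λ l → trans (lift-removeAt 0# (combination a b) l)
                       (·-congˡ a (λ i → sym (lift-removeAt 0# (b i) l))))
      }

    *ᵥ-lift : ∀ i t x → A i · lift t x ≈ t * A i j + B i · x
    *ᵥ-lift i t x = begin
      A i · lift t x                                              ≈⟨ ·-removeAt j (A i) (lift t x) ⟩
      A i j * lift t x j + Aᵢ′ · removeAt (lift t x) j            ≈⟨ +-cong (*-congˡ (lift-pivot t x)) (·-congˡ Aᵢ′ (lift-removeAt t x)) ⟩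
      A i j * (t + u) + Aᵢ′ · x                                   ≈⟨ solve 4 (λ a t u v → a :* (t :+ u) :+ v := t :* a :+ (v :+ a :* u))
                                                                       refl (A i j) t u (Aᵢ′ · x) ⟩
      t * A i j + (Aᵢ′ · x + A i j * u)                           ≈⟨ +-congˡ (+-congˡ (·-*-assoc (A i j) multiplier x)) ⟨
      t * A i j + (Aᵢ′ · x + (λ l → A i j * multiplier l) · x)    ≈⟨ +-congˡ (·-distribʳ-+ Aᵢ′ _ x) ⟨
      t * A i j + B i · x                                         ∎
      where
      Aᵢ′ = removeAt (A i) j
      u   = multiplier · x

    B₀≋𝟎 : B zero ≋ 𝟎
    B₀≋𝟎 l = begin
      a + A zero j * - (a * pivot⁻¹)     ≈⟨ +-congˡ (-‿distribʳ-* (A zero j) (a * pivot⁻¹)) ⟨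
      a - A zero j * (a * pivot⁻¹)       ≈⟨ +-congˡ (-‿cong (solve 3 (λ p a q → p :* (a :* q) := a :* (p :* q)) refl (A zero j) a pivot⁻¹)) ⟩
      a - a * (A zero j * pivot⁻¹)       ≈⟨ +-congˡ (-‿cong (*-congˡ (proj₂ (inverse (A zero j) pivot≉0)))) ⟩
      a - a * 1#                         ≈⟨ +-congˡ (-‿cong (*-identityʳ a)) ⟩
      a - a                              ≈⟨ -‿inverseʳ a ⟩
      0#                                 ∎
      where a = A zero (punchIn j l)

    B₀·x≈0 : ∀ x → B zero · x ≈ 0#
    B₀·x≈0 x = trans (·-congʳ x B₀≋𝟎) (·-zeroˡ x)

    *ᵥ-lift₀ : ∀ i x → A i · lift 0# x ≈ B i · x
    *ᵥ-lift₀ i x = trans (*ᵥ-lift i 0# x) (trans (+-congʳ (zeroˡ (A i j))) (+-identityˡ (B i · x)))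

    *ᵥ-parameter : ∀ i x → A i · x ≈ parameter x * A i j + B i · removeAt x j
    *ᵥ-parameter i x = trans (·-congˡ (A i) (≋-sym (lift-parameter x)))
                             (*ᵥ-lift i (parameter x) (removeAt x j))

    nullspace⇒parameter≈0 : ∀ x → x ∈ nullspace A → parameter x ≈ 0#
    nullspace⇒parameter≈0 x Ax≋𝟎 = *-cancelʳ-≈0 pivot≉0 (begin
      parameter x * A zero j                               ≈⟨ +-identityʳ _ ⟨
      parameter x * A zero j + 0#                          ≈⟨ +-congˡ (B₀·x≈0 (removeAt x j)) ⟨
      parameter x * A zero j + B zero · removeAt x j       ≈⟨ *ᵥ-parameter zero x ⟨
      A zero · x                                           ≈⟨ Ax≋𝟎 zero ⟩
      0#                                                   ∎)

    -- The pivot equation forces the parameter to be zero, so the pivot coordinate of a solution is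
    -- determined by the others and the nullity does not change.
    nullspace-dimension : HasNullity (B ∘ suc) d → HasNullity A d
    nullspace-dimension = HasDimension-map lift₀-isLinear
      (λ x lx≋𝟎 l → trans (sym (lift-removeAt 0# x l)) (lx≋𝟎 (punchIn j l)))
      (λ {x} Bx≋𝟎 → λ { zero    → trans (*ᵥ-lift₀ zero x) (B₀·x≈0 x)
                      ; (suc i) → trans (*ᵥ-lift₀ (suc i) x) (Bx≋𝟎 i) })
      (λ {y} Ay≋𝟎 →
        let ly≋y : lift 0# (removeAt y j) ≋ y
            ly≋y = ≋-trans (lift-cong (sym (nullspace⇒parameter≈0 y Ay≋𝟎)) ≋-refl) (lift-parameter y)
        in removeAt y j
         , (λ i → trans (sym (*ᵥ-lift₀ (suc i) (removeAt y j))) (nullspace-resp-≋ A (≋-sym ly≋y) Ay≋𝟎 (suc i)))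
         , ly≋y)

    -- The pivot column joins the image basis of `B ∘ suc`, whose vectors get first entry `0#`. Only
    -- the pivot column has a nonzero first entry, which forces its coefficient in a vanishing
    -- combination to be zero; in the image of `x` its coefficient is `parameter x`.
    image-dimension : HasRank (B ∘ suc) d → HasRank A (suc d)
    image-dimension {d} (b , isBasis) = b⁺ , record
      { members     = λ
        -- `lift 1# 𝟎` is the unit vector at `j`, which `A` sends to its pivot column.
        { zero    → lift 1# 𝟎 , λ i → trans (*ᵥ-lift i 1# 𝟎)
                      (trans (+-cong (*-identityˡ (A i j)) (·-zeroʳ (B i))) (+-identityʳ (A i j)))
        ; (suc k) → let x , Bx≋bₖ = members k in lift 0# x , λ
            { zero    → trans (*ᵥ-lift₀ zero x) (B₀·x≈0 x)
            ; (suc i) → trans (*ᵥ-lift₀ (suc i) x) (Bx≋bₖ i) }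
        }
      ; independent = λ a ab≋𝟎 →
          let a₀≈0 : a zero ≈ 0#
              a₀≈0 = *-cancelʳ-≈0 pivot≉0 (begin
                a zero * A zero j                          ≈⟨ +-identityʳ _ ⟨
                a zero * A zero j + 0#                     ≈⟨ +-congˡ (·-zeroʳ (a ∘ suc)) ⟨
                combination a b⁺ zero                      ≈⟨ ab≋𝟎 zero ⟩
                0#                                         ∎)
              as≋𝟎 = independent (a ∘ suc) λ i → begin
                combination (a ∘ suc) b i                            ≈⟨ +-identityˡ _ ⟨
                0# + combination (a ∘ suc) b i                       ≈⟨ +-congʳ (trans (*-congʳ a₀≈0) (zeroˡ _)) ⟨
                combination a b⁺ (suc i)                             ≈⟨ ab≋𝟎 (suc i) ⟩
                0#                                                   ∎
          in λ { zero → a₀≈0 ; (suc k) → as≋𝟎 k }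
      ; spanning    = λ y (x , Ax≋y) →
          let a , ab≋Bx = spanning _ (removeAt x j , ≋-refl)
          in parameter x ∷ a , λ
            { zero    → trans (+-congˡ (trans (·-zeroʳ a) (sym (B₀·x≈0 (removeAt x j)))))
                              (trans (sym (*ᵥ-parameter zero x)) (Ax≋y zero))
            ; (suc i) → trans (+-congˡ (ab≋Bx i))
                              (trans (sym (*ᵥ-parameter (suc i) x)) (Ax≋y (suc i))) }
      }
      where
      open IsBasis isBasis
      b⁺ : Vector (Vec (suc _)) (suc d)
      b⁺ = (λ i → A i j) ∷ (λ k → 0# ∷ b k)

    pivot-rankNullity : RankNullity (B ∘ suc) → RankNullity A
    pivot-rankNullity R = record
      { nullspaceBasis = nullspace-dimension nullspaceBasis
      ; imageBasis     = image-dimension imageBasis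
      ; nullity+rank≡n = ≡.trans (ℕ.+-suc nullity rank) (≡.cong suc nullity+rank≡n)
      ; rank≤m         = ℕ.s≤s rank≤m
      }
      where open RankNullity R

  -- Decidability of `_≈_` settles whether the first row offers a pivot or vanishes. The pivot is
  -- sought along the row, so no rows are exchanged and each call drops one row.
  rankNullity : (A : Matrix m n) → RankNullity A
  rankNullity {zero}          A = noRows-rankNullity A
  rankNullity {suc m} {zero}  A = zeroRow-rankNullity A (λ ()) (rankNullity (A ∘ suc))
  rankNullity {suc m} {suc n} A with any? (λ j → ¬? (A zero j ≟ 0#))
  ... | yes (j , A₀ⱼ≉0) = pivot-rankNullity (rankNullity (B ∘ suc))
    where open Pivot A j A₀ⱼ≉0
  ... | no ¬pivot = zeroRow-rankNullity A
    (λ j → decidable-stable (A zero j ≟ 0#) λ A₀ⱼ≉0 → ¬pivot (j , A₀ⱼ≉0))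
    (rankNullity (A ∘ suc))

  -- Linear dependence and uniqueness of dimension.

  Independent : Vector (Vec n) d → Set (c ⊔ ℓ₁)
  Independent v = ∀ a → combination a v ≋ 𝟎 → a ≋ 𝟎

  -- A zero member at `i` would satisfy the nontrivial relation with coefficients `I i`.
  independent⇒≉𝟎 : {v : Vector (Vec n) d} → Independent v → ∀ i → ¬ v i ≋ 𝟎
  independent⇒≉𝟎 {v = v} independent i vᵢ≋𝟎 = 1≉0 (trans (sym (reflexive (I-diag i)))
    (independent (I i) (λ j → trans (I-· i (λ l → v l j)) (vᵢ≋𝟎 j)) i))

  -- The coordinates of the `e` vectors form a matrix `C` whose transpose has more columns than
  -- rows. A basis vector of the nullspace of that transpose is a nonzero relation among the rows of
  -- `C`, hence among the vectors.
  dependent : {V : Pred (Vec n) p} {v : Vector (Vec n) e} →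
              HasDimension V d → (∀ i → V (v i)) → d ℕ.< e →
              ∃ λ a → combination a v ≋ 𝟎 × ¬ a ≋ 𝟎
  dependent {e = e} {d = d} {v = v} (b , isBasis) v∈V d<e =
    a , (λ j → begin
      combination a v j                                ≈⟨ combination-congʳ a (λ i → proj₂ (coordinates i)) j ⟨
      combination a (λ i → combination (C i) b) j      ≈⟨ combination-assoc a C b j ⟩
      combination (combination a C) b j                ≈⟨ combination-congˡ b aC≋𝟎 j ⟩
      combination 𝟎 b j                                ≈⟨ ·-zeroˡ (λ i → b i j) ⟩
      0#                                               ∎)
    , independent⇒≉𝟎 (IsBasis.independent (proj₂ nullspaceBasis)) first
    where
    coordinates = λ i → IsBasis.spanning isBasis (v i) (v∈V i)
    C : Matrix e d
    C i = proj₁ (coordinates i)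
    open RankNullity (rankNullity (C ᵗ))
    -- Otherwise `nullity ℕ.+ rank`, which equals `e`, would be at most `d`.
    0<nullity : 0 ℕ.< nullity
    0<nullity = ℕ.≰⇒> λ nullity≤0 → ℕ.<⇒≱ d<e
      (≡.subst (ℕ._≤ d) nullity+rank≡n (ℕ.+-mono-≤ nullity≤0 rank≤m))
    first = fromℕ< 0<nullity
    a = proj₁ nullspaceBasis first
    aC≋𝟎 : combination a C ≋ 𝟎
    aC≋𝟎 l = trans (·-comm a (λ i → C i l)) (IsBasis.members (proj₂ nullspaceBasis) first l)

  independent⇒≤ : {V : Pred (Vec n) p} {v : Vector (Vec n) e} →
                  HasDimension V d → (∀ i → V (v i)) → Independent v → e ℕ.≤ d
  independent⇒≤ V-dim v∈V independent = ℕ.≮⇒≥ λ d<e →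
    let a , av≋𝟎 , a≉𝟎 = dependent V-dim v∈V d<e in a≉𝟎 (independent a av≋𝟎)

  dimension-unique : {V : Pred (Vec n) p} → HasDimension V d → HasDimension V e → d ≡ e
  dimension-unique V-dim@(b , B) V-dim′@(b′ , B′) = ℕ.≤-antisym
    (independent⇒≤ V-dim′ (IsBasis.members B) (IsBasis.independent B))
    (independent⇒≤ V-dim (IsBasis.members B′) (IsBasis.independent B′))

  -- Adjoining `x` gives one vector too many, hence a nontrivial relation. Independence of `v` keeps
  -- the coefficient of `x` from being zero, and dividing by it solves for `x`.
  independent⇒spanning : {V : Pred (Vec n) p} {v : Vector (Vec n) d} →
                         HasDimension V d → (∀ i → V (v i)) → Independent v →
                         ∀ x → V x → ∃ λ a → combination a v ≋ x
  independent⇒spanning {v = v} V-dim v∈V independent x x∈V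
    with a , a·xv≋𝟎 , a≉𝟎 ← dependent {v = x ∷ v} V-dim (λ { zero → x∈V ; (suc i) → v∈V i }) ℕ.≤-refl
    with a zero ≟ 0#
  ... | yes a₀≈0 = contradiction (λ { zero → a₀≈0 ; (suc i) → as≋𝟎 i }) a≉𝟎
    where
    as≋𝟎 = independent (a ∘ suc) λ j → begin
      combination (a ∘ suc) v j                    ≈⟨ +-identityˡ _ ⟨
      0# + combination (a ∘ suc) v j               ≈⟨ +-congʳ (trans (*-congʳ a₀≈0) (zeroˡ (x j))) ⟨
      combination a (x ∷ v) j                      ≈⟨ a·xv≋𝟎 j ⟩
      0#                                           ∎
  ... | no a₀≉0 = (λ i → - r * a (suc i)) , λ j → begin
      (λ i → - r * a (suc i)) · (λ i → v i j)      ≈⟨ ·-*-assoc (- r) (a ∘ suc) (λ i → v i j) ⟩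
      - r * combination (a ∘ suc) v j              ≈⟨ *-congˡ (+-inverseʳ-unique _ _ (a·xv≋𝟎 j)) ⟩
      - r * - (a zero * x j)                       ≈⟨ -x*-y≈x*y r (a zero * x j) ⟩
      r * (a zero * x j)                           ≈⟨ solve 3 (λ r a x → r :* (a :* x) := (a :* r) :* x) refl r (a zero) (x j) ⟩
      a zero * r * x j                             ≈⟨ *-congʳ (proj₂ (inverse (a zero) a₀≉0)) ⟩
      1# * x j                                     ≈⟨ *-identityˡ (x j) ⟩
      x j                                          ∎
    where r = proj₁ (inverse (a zero) a₀≉0)

  -- Vectors cut into two blocks.

  sum-↑ : ∀ k (f : Vec (k ℕ.+ s)) → sum f ≈ sum (take k f) + sum (drop k f)
  sum-↑ zero    f = sym (+-identityˡ (sum f))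
  sum-↑ (suc k) f = trans (+-congˡ (sum-↑ k (f ∘ suc))) (sym (+-assoc (f zero) _ _))

  take-++ : (y : Vec k) (z : Vec s) → take k (y ++ z) ≋ y
  take-++ y z i = reflexive (lookup-++ˡ y z i)

  drop-++ : (y : Vec k) (z : Vec s) → drop k (y ++ z) ≋ z
  drop-++ y z j = reflexive (lookup-++ʳ y z j)

  ·-++ : (x : Vec (k ℕ.+ s)) (y : Vec k) (z : Vec s) → x · (y ++ z) ≈ take k x · y + drop k x · z
  ·-++ {k} x y z = trans (sum-↑ k (λ i → x i * (y ++ z) i)) (+-cong
    (sum-cong-≋ λ i → *-congˡ (take-++ y z i))
    (sum-cong-≋ λ i → *-congˡ (drop-++ y z i)))

  ≋-by-parts : ∀ k {x y : Vec (k ℕ.+ s)} → take k x ≋ take k y → drop k x ≋ drop k y → x ≋ y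
  ≋-by-parts k {x} {y} xK≋yK xS≋yS v with splitAt k v in eq
  ... | inj₁ i = ≡.subst (λ v → x v ≈ y v) (splitAt⁻¹-↑ˡ eq) (xK≋yK i)
  ... | inj₂ j = ≡.subst (λ v → x v ≈ y v) (splitAt⁻¹-↑ʳ eq) (xS≋yS j)

  take-++-drop : ∀ k (x : Vec (k ℕ.+ s)) → take k x ++ drop k x ≋ x
  take-++-drop k x = ≋-by-parts k
    (take-++ (take k x) (drop k x))
    (drop-++ (take k x) (drop k x))

  𝟎++-isLinear : IsLinear {s} (𝟎 {k} ++_)
  𝟎++-isLinear {s} {k} = record
    { cong             = λ {x} {y} x≋y → ≋-by-parts k
        (≋-trans (take-++ 𝟎 x) (≋-sym (take-++ 𝟎 y)))
        (≋-trans (drop-++ {k} 𝟎 x) (≋-trans x≋y (≋-sym (drop-++ {k} 𝟎 y))))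
    ; combination-homo = λ a b → ≋-by-parts k
        (λ i → trans (take-++ 𝟎 (combination a b) i)
                     (trans (sym (·-zeroʳ a)) (·-congˡ a λ l → sym (take-++ 𝟎 (b l) i))))
        (λ j → trans (drop-++ {k} 𝟎 (combination a b) j)
                     (·-congˡ a λ l → sym (drop-++ {k} 𝟎 (b l) j)))
    }

  𝟎++-injective : ∀ k (z : Vec s) → 𝟎 {k} ++ z ≋ 𝟎 → z ≋ 𝟎
  𝟎++-injective k z 0z≋𝟎 j = trans (sym (drop-++ {k} 𝟎 z j)) (0z≋𝟎 (k ↑ʳ j))

  -- Entries of an adjacency matrix.

  module _ (G : Graph n) where
    open Graph G

    adjacency-~ : ∀ {u v} → u ~ v → adjacency G u v ≡ 1#
    adjacency-~ {u} {v} u~v = ≡.cong (if_then 1# else 0#) (dec-true (u ~? v) u~v)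

    adjacency-≁ : ∀ {u v} → ¬ u ~ v → adjacency G u v ≡ 0#
    adjacency-≁ {u} {v} u≁v = ≡.cong (if_then 1# else 0#) (dec-false (u ~? v) u≁v)

    adjacency-sym : ∀ u v → adjacency G u v ≡ adjacency G v u
    adjacency-sym u v with v ~? u
    ... | yes v~u = adjacency-~ (~-sym v~u)
    ... | no v≁u  = adjacency-≁ (v≁u ∘ ~-sym)

  -- Split graphs

  module Split {k s} (Sp : SplitGraph k s) where
    open SplitGraph Sp using (graph; K-clique; S-independent; S-side; ~-irrefl)

    R : Matrix k s
    R = biadjacency Sp

    -- The condition `Supp graph ⊆ S-side` restated on vectors instead of vertices; the equivalence
    -- is proved in two lemmas below.
    Supported-on-S : Set (c ⊔ ℓ₁)
    Supported-on-S = ∀ x → x ∈ 𝒩 graph → take k x ≋ 𝟎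

    -- Irreflexivity gives the diagonal and the clique gives the rest. The sign is pulled out so
    -- that the matrix `I ⊟ J` of the null equations appears.
    adjacency-KK : ∀ i j → adjacency graph (i ↑ˡ s) (j ↑ˡ s) ≈ - (I ⊟ J) i j
    adjacency-KK i j with i ≟ᶠ j
    ... | yes ≡.refl = trans (reflexive (adjacency-≁ graph (~-irrefl ≡.refl)))
                             (trans (sym -0#≈0#) (-‿cong (sym (-‿inverseʳ 1#))))
    ... | no i≢j     = trans (reflexive (adjacency-~ graph (K-clique i j i≢j)))
                             (trans (sym (-‿involutive 1#)) (-‿cong (sym (+-identityˡ (- 1#)))))

    row-K : ∀ i (xK : Vec k) (xS : Vec s) →
            adjacency graph (i ↑ˡ s) · (xK ++ xS) ≈ (R *ᵥ xS) i - ((I ⊟ J) *ᵥ xK) i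
    row-K i xK xS = begin
      adjacency graph (i ↑ˡ s) · (xK ++ xS)                                      ≈⟨ ·-++ (adjacency graph (i ↑ˡ s)) xK xS ⟩
      (λ j → adjacency graph (i ↑ˡ s) (j ↑ˡ s)) · xK + R i · xS                  ≈⟨ +-congʳ (·-congʳ xK (adjacency-KK i)) ⟩
      (λ j → - (I ⊟ J) i j) · xK + R i · xS                                      ≈⟨ +-congʳ (·-negˡ ((I ⊟ J) i) xK) ⟩
      - ((I ⊟ J) i · xK) + R i · xS                                              ≈⟨ +-comm _ _ ⟩
      R i · xS - (I ⊟ J) i · xK                                                  ∎

    row-S : ∀ j (xK : Vec k) (xS : Vec s) →
            adjacency graph (k ↑ʳ j) · (xK ++ xS) ≈ (R ᵗ *ᵥ xK) j
    row-S j xK xS = begin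
      adjacency graph (k ↑ʳ j) · (xK ++ xS)                                                            ≈⟨ ·-++ (adjacency graph (k ↑ʳ j)) xK xS ⟩
      (λ i → adjacency graph (k ↑ʳ j) (i ↑ˡ s)) · xK + (λ l → adjacency graph (k ↑ʳ j) (k ↑ʳ l)) · xS  ≈⟨ +-cong
          (·-congʳ xK λ i → reflexive (adjacency-sym graph (k ↑ʳ j) (i ↑ˡ s)))
          (·-congʳ xS λ l → reflexive (adjacency-≁ graph (S-independent j l))) ⟩
      (R ᵗ) j · xK + 𝟎 · xS                                                                            ≈⟨ +-congˡ (·-zeroˡ xS) ⟩
      (R ᵗ) j · xK + 0#                                                                                ≈⟨ +-identityʳ _ ⟩
      (R ᵗ) j · xK                                                                                     ∎

    𝒩⇔ : ∀ xK xS → (xK ++ xS) ∈ 𝒩 graph ⇔ (((I ⊟ J) *ᵥ xK ≋ R *ᵥ xS) × (R ᵗ *ᵥ xK ≋ 𝟎))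
    𝒩⇔ xK xS = mk⇔
      (λ x∈𝒩 →
        (λ i → sym (x∙y⁻¹≈ε⇒x≈y _ _ (trans (sym (row-K i xK xS)) (x∈𝒩 (i ↑ˡ s)))))
        , λ j → trans (sym (row-S j xK xS)) (x∈𝒩 (k ↑ʳ j)))
      (λ (I-JxK≋RxS , RᵗxK≋𝟎) → ≋-by-parts k
        (λ i → trans (row-K i xK xS) (x≈y⇒x∙y⁻¹≈ε (sym (I-JxK≋RxS i))))
        (λ j → trans (row-S j xK xS) (RᵗxK≋𝟎 j)))

    -- Serves null vectors not given as a concatenation: `take k x ++ drop k x` agrees with `x` only
    -- pointwise.
    𝒩⇒ : ∀ {x} → x ∈ 𝒩 graph → ((I ⊟ J) *ᵥ take k x ≋ R *ᵥ drop k x) × (R ᵗ *ᵥ take k x ≋ 𝟎)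
    𝒩⇒ {x} x∈𝒩 = Equivalence.to (𝒩⇔ (take k x) (drop k x))
      (nullspace-resp-≋ (adjacency graph) (≋-sym (take-++-drop k x)) x∈𝒩)

    ZeroExtension⊆𝒩 : ZeroExtension k (nullspace R) ⊆ 𝒩 graph
    ZeroExtension⊆𝒩 (z , Rz≋𝟎 , 0z≋x) = nullspace-resp-≋ (adjacency graph) 0z≋x
      (Equivalence.from (𝒩⇔ 𝟎 z)
        ((λ i → trans (·-zeroʳ ((I ⊟ J) i)) (sym (Rz≋𝟎 i))) , λ j → ·-zeroʳ ((R ᵗ) j)))

    Supported-on-S⇒Supp⊆S : Supported-on-S → Supp graph ⊆ S-side
    Supported-on-S⇒Supp⊆S supported {v} (x , x∈𝒩 , xᵥ≉0) with splitAt k v in eq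
    ... | inj₁ i = contradiction (≡.subst (λ v → x v ≈ 0#) (splitAt⁻¹-↑ˡ eq) (supported x x∈𝒩 i)) xᵥ≉0
    ... | inj₂ j = j , ≡.sym (splitAt⁻¹-↑ʳ eq)

    -- A nonzero entry at a clique vertex would place that vertex in the support and so in `S`,
    -- against disjointness. Decidability of `_≈_` turns this refutation into an equality.
    Supp⊆S⇒Supported-on-S : Supp graph ⊆ S-side → Supported-on-S
    Supp⊆S⇒Supported-on-S Supp⊆S x x∈𝒩 i = decidable-stable (x (i ↑ˡ s) ≟ 0#) λ xᵢ≉0 →
      let j , i≡j = Supp⊆S (x , x∈𝒩 , xᵢ≉0) in ↑ˡ≢↑ʳ i≡j
      where
      ↑ˡ≢↑ʳ : ∀ {i : Fin k} {j : Fin s} → ¬ i ↑ˡ s ≡ k ↑ʳ j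
      ↑ˡ≢↑ʳ {i} {j} i≡j with () ← ≡.trans (≡.sym (splitAt-↑ˡ k i s)) (≡.trans (≡.cong (splitAt k) i≡j) (splitAt-↑ʳ k s j))

    𝒩⊆ZeroExtension⇒Supp⊆S : 𝒩 graph ⊆ ZeroExtension k (nullspace R) → Supp graph ⊆ S-side
    𝒩⊆ZeroExtension⇒Supp⊆S 𝒩⊆ = Supported-on-S⇒Supp⊆S take≋𝟎
      where
      take≋𝟎 : Supported-on-S
      take≋𝟎 x x∈𝒩 i with z , _ , 0z≋x ← 𝒩⊆ {x} x∈𝒩 =
        trans (sym (0z≋x (i ↑ˡ s))) (take-++ 𝟎 z i)

    -- Once the clique block vanishes, the first null equation says that `R` annihilates the other
    -- block, which is then the witness.
    Supp⊆S⇒𝒩⊆ZeroExtension : Supp graph ⊆ S-side → 𝒩 graph ⊆ ZeroExtension k (nullspace R)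
    Supp⊆S⇒𝒩⊆ZeroExtension Supp⊆S {x} x∈𝒩 =
      drop k x
      , (λ i → begin
          R i · drop k x             ≈⟨ proj₁ (𝒩⇒ {x} x∈𝒩) i ⟨
          (I ⊟ J) i · take k x       ≈⟨ ·-congˡ ((I ⊟ J) i) xK≋𝟎 ⟩
          (I ⊟ J) i · 𝟎              ≈⟨ ·-zeroʳ ((I ⊟ J) i) ⟩
          0#                         ∎)
      , ≋-by-parts k
          (≋-trans (take-++ 𝟎 (drop k x)) (≋-sym xK≋𝟎))
          (drop-++ {k} 𝟎 (drop k x))
      where
      xK≋𝟎 : take k x ≋ 𝟎
      xK≋𝟎 = Supp⊆S⇒Supported-on-S Supp⊆S x x∈𝒩

    ≐⇔Supp⊆S : (ZeroExtension k (nullspace R) ≐ 𝒩 graph) ⇔ (Supp graph ⊆ S-side)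
    ≐⇔Supp⊆S = mk⇔ ≐⇒Supp⊆S Supp⊆S⇒≐
      where
      ≐⇒Supp⊆S : ZeroExtension k (nullspace R) ≐ 𝒩 graph → Supp graph ⊆ S-side
      ≐⇒Supp⊆S (_ , 𝒩⊆) = 𝒩⊆ZeroExtension⇒Supp⊆S 𝒩⊆
      Supp⊆S⇒≐ : Supp graph ⊆ S-side → ZeroExtension k (nullspace R) ≐ 𝒩 graph
      Supp⊆S⇒≐ Supp⊆S = ZeroExtension⊆𝒩 , Supp⊆S⇒𝒩⊆ZeroExtension Supp⊆S

    -- The difference of `s` and the rank is taken in the integers, where subtraction is not
    -- truncated.
    nullities : ∀ {nlSp nlR rkR} →
                HasNullity (adjacency graph) nlSp → HasNullity R nlR → HasRank R rkR →
                (nlSp ≥ nlR) × (+ nlR ≡ s ⊖ rkR) × ((nlSp ≡ nlR) ⇔ (Supp graph ⊆ S-side))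
    nullities {nlSp} {nlR} {rkR} 𝒩-dim R-null@(b , isBasis) R-rank =
      independent⇒≤ 𝒩-dim 0b∈𝒩 0b-independent
      , nlR≡s⊖rkR
      -- Here the zero extension maps the nullspace of `R` onto that of the graph, so `nlR` is a
      -- dimension of the latter as well.
      , mk⇔ nl≡⇒Supp⊆S λ Supp⊆S → dimension-unique 𝒩-dim
          (HasDimension-map 𝟎++-isLinear (𝟎++-injective k)
            (λ {z} Rz≋𝟎 → ZeroExtension⊆𝒩 (z , Rz≋𝟎 , ≋-refl))
            (Supp⊆S⇒𝒩⊆ZeroExtension Supp⊆S)
            R-null)
      where
      open IsBasis isBasis
      0b : Vector (Vec (k ℕ.+ s)) nlR
      0b i = 𝟎 {k} ++ b i
      0b∈𝒩 : ∀ i → 𝒩 graph (0b i)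
      0b∈𝒩 i = ZeroExtension⊆𝒩 (b i , members i , ≋-refl)
      0b-independent : Independent 0b
      0b-independent a a0b≋𝟎 = independent a (𝟎++-injective k (combination a b)
        (≋-trans (IsLinear.combination-homo 𝟎++-isLinear a b) a0b≋𝟎))
      -- As many independent vectors as the dimension must span, so every null vector is a
      -- combination of vectors that vanish on the clique.
      nl≡⇒Supp⊆S : nlSp ≡ nlR → Supp graph ⊆ S-side
      nl≡⇒Supp⊆S ≡.refl = Supported-on-S⇒Supp⊆S λ x x∈𝒩 i →
        let a , a0b≋x = independent⇒spanning 𝒩-dim 0b∈𝒩 0b-independent x x∈𝒩
        in begin
          x (i ↑ˡ s)                      ≈⟨ a0b≋x (i ↑ˡ s) ⟨
          a · (λ l → 0b l (i ↑ˡ s))       ≈⟨ ·-congˡ a (λ l → take-++ 𝟎 (b l) i) ⟩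
          a · 𝟎                           ≈⟨ ·-zeroʳ a ⟩
          0#                              ∎
      nlR+rkR≡s : nlR ℕ.+ rkR ≡ s
      nlR+rkR≡s = ≡.trans
        (≡.cong₂ ℕ._+_ (dimension-unique R-null nullspaceBasis) (dimension-unique R-rank imageBasis))
        nullity+rank≡n
        where open RankNullity (rankNullity R)
      -- With `s` replaced by `nlR ℕ.+ rkR`, the integer difference reduces to a subtraction of
      -- naturals that is not cut off.
      nlR≡s⊖rkR : + nlR ≡ s ⊖ rkR
      nlR≡s⊖rkR = ≡.subst (λ t → + nlR ≡ t ⊖ rkR) nlR+rkR≡s
        (≡.sym (≡.trans (⊖-≥ (ℕ.m≤n+m rkR nlR)) (≡.cong +_ (ℕ.m+n∸n≡m nlR rkR))))

    -- When `J` annihilates the clique block, the first null equation places that block in the image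
    -- of `R`, while the second makes it orthogonal to this image; so it is orthogonal to itself.
    𝟏·take≈0⇒take≋𝟎 : ∀ x → x ∈ 𝒩 graph → 𝟏 · take k x ≈ 0# → take k x ≋ 𝟎
    𝟏·take≈0⇒take≋𝟎 x x∈𝒩 𝟏·xK≈0 = x·x≈0⇒x≋𝟎 xK (begin
      xK · xK               ≈⟨ ·-congˡ xK xK≋RxS ⟩
      xK · (R *ᵥ xS)        ≈⟨ *ᵥ-adjoint R xK xS ⟩
      (R ᵗ *ᵥ xK) · xS      ≈⟨ ·-congʳ xS (proj₂ (𝒩⇒ {x} x∈𝒩)) ⟩
      𝟎 · xS                ≈⟨ ·-zeroˡ xS ⟩
      0#                    ∎)
      where
      xK = take k x
      xS = drop k x
      xK≋RxS : xK ≋ R *ᵥ xS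
      xK≋RxS i = begin
        xK i                                      ≈⟨ I-· i xK ⟨
        I i · xK                                  ≈⟨ +-identityʳ _ ⟨
        -- The added zero becomes the contribution of `J`, whose every row is `𝟏`.
        I i · xK + 0#                             ≈⟨ +-congˡ (trans (-‿cong 𝟏·xK≈0) -0#≈0#) ⟨
        I i · xK - 𝟏 · xK                         ≈⟨ +-congˡ (·-negˡ 𝟏 xK) ⟨
        I i · xK + (λ j → - 1#) · xK              ≈⟨ ·-distribʳ-+ (I i) (λ _ → - 1#) xK ⟨
        (I ⊟ J) i · xK                            ≈⟨ proj₁ (𝒩⇒ {x} x∈𝒩) i ⟩
        R i · xS                                  ∎

    -- The clique block of a null vector is orthogonal to the image of `R`, hence to `𝟏`, which is
    -- the hypothesis of the previous lemma.
    𝟏∈imR⇒Supp⊆S : 𝟏 ∈ im R → Supp graph ⊆ S-side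
    𝟏∈imR⇒Supp⊆S (y , Ry≋𝟏) = Supported-on-S⇒Supp⊆S λ x x∈𝒩 → 𝟏·take≈0⇒take≋𝟎 x x∈𝒩 (begin
      𝟏 · take k x                  ≈⟨ ·-comm 𝟏 (take k x) ⟩
      take k x · 𝟏                  ≈⟨ ·-congˡ (take k x) Ry≋𝟏 ⟨
      take k x · (R *ᵥ y)           ≈⟨ *ᵥ-adjoint R (take k x) y ⟩
      (R ᵗ *ᵥ take k x) · y         ≈⟨ ·-congʳ y (proj₂ (𝒩⇒ {x} x∈𝒩)) ⟩
      𝟎 · y                         ≈⟨ ·-zeroˡ y ⟩
      0#                            ∎)

    𝟏·xK≈0⇒xK≋𝟎 : ∀ xK xS → (xK ++ xS) ∈ 𝒩 graph → 𝟏 · xK ≈ 0# → xK ≋ 𝟎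
    𝟏·xK≈0⇒xK≋𝟎 xK xS x∈𝒩 𝟏·xK≈0 = ≋-trans (≋-sym take≋xK)
      (𝟏·take≈0⇒take≋𝟎 (xK ++ xS) x∈𝒩 (trans (·-congˡ 𝟏 take≋xK) 𝟏·xK≈0))
      where take≋xK = take-++ xK xS

theorem3p2 : ∀ {c ℓ₁ ℓ₂} (ℝ : Reals c ℓ₁ ℓ₂) →
  let open Reals ℝ
      open LinearAlgebra ℝ
  in ∀ {k s : ℕ} (Sp : SplitGraph k s) →
  let G = SplitGraph.graph Sp
      S = SplitGraph.S-side Sp
      R = biadjacency Sp
  in
    (∀ (xK : Vec k) (xS : Vec s) →
       (xK ++ xS) ∈ 𝒩 G ⇔ (((I ⊟ J) *ᵥ xK ≋ R *ᵥ xS) × (R ᵗ *ᵥ xK ≋ 𝟎)))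
    ×
    ((ZeroExtension k (nullspace R) ⊆ 𝒩 G)
      × ((ZeroExtension k (nullspace R) ≐ 𝒩 G) ⇔ (Supp G ⊆ S)))
    ×
    (∃ (HasNullity (adjacency G)) × ∃ (HasNullity R) × ∃ (HasRank R)
      × (∀ {nlSp nlR rkR : ℕ} →
           HasNullity (adjacency G) nlSp → HasNullity R nlR → HasRank R rkR →
           (nlSp ≥ nlR) × (+ nlR ≡ s ⊖ rkR) × ((nlSp ≡ nlR) ⇔ (Supp G ⊆ S))))
    ×
    (∀ (xK : Vec k) (xS : Vec s) →
       (xK ++ xS) ∈ 𝒩 G → 𝟏 · xK ≈ 0# → xK ≋ 𝟎)
    ×
    (𝟏 ∈ im R → Supp G ⊆ S)
theorem3p2 ℝ Sp =
    𝒩⇔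
  , (ZeroExtension⊆𝒩 , ≐⇔Supp⊆S)
  -- Elimination provides the existence of the three dimensions; `nullities` then treats all their
  -- values.
  , ( (_ , nullspaceBasis (rankNullity (adjacency (SplitGraph.graph Sp))))
    , (_ , nullspaceBasis (rankNullity R))
    , (_ , imageBasis (rankNullity R))
    , nullities)
  , 𝟏·xK≈0⇒xK≋𝟎
  , 𝟏∈imR⇒Supp⊆S
  where
  open LinearAlgebra ℝ using (adjacency)
  open RealLinearAlgebra ℝ
  open RankNullity
  open Split Sp
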